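{- Let $t\geq 2$ be an integer and $f:\mathbb{N}\to\mathbb{N}$ with $\lim_{n\to\infty}f(n)=\infty$. Then there is a constant $C$ (depending only on $t$ and $f$) such that for every $n$ and every set $\mathcal{A}\subseteq\{0,1\}^n$ with $|\mathcal{A}|=f(n)$, there is a first-order sentence over $\tau_{\mathsf{string}}$ with at most $3\log_3(n)+\log_t(f(n))+C$ quantifiers that is true in $\mathbf{B}_w$ for all $w\in\mathcal{A}$ and false in $\mathbf{B}_{w'}$ for all $w'\in\{0,1\}^n\setminus\mathcal{A}$.
   Context: Vocabulary $\tau_{\mathsf{string}}=\langle <, S;\ \mathsf{min},\mathsf{max}\rangle$ with $<$ binary, $S$ unary, $\mathsf{min},\mathsf{max}$ constants. A string $w=w_1\cdots w_n\in\{0,1\}^n$ ($n\geq 1$) is encoded by the structure $\mathbf{B}_w$ with universe $\{1,\dots,n\}$, $<$ the usual order, $S=\{i: w_i=1\}$, $\mathsf{min}=1$, $\mathsf{max}=n$. The number of quantifiers is the number of quantifier occurrences. -}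

module Defs where

open import Data.Bool using (Bool; true)
open import Data.Fin as Fin using (Fin; zero; fromℕ)
open import Data.Nat using (ℕ; suc; _+_; _*_; _^_; _≤_; NonZero)
open import Data.Product using (_×_; Σ-syntax; ∃-syntax)
open import Data.Sum using (_⊎_)
open import Data.Vec using (Vec; []; _∷_; lookup)
open import Relation.Binary.PropositionalEquality using (_≡_)
open import Relation.Nullary using (¬_)

infix  8 _<′_ _≐_
infix  7 ¬′_
infixr 6 _∧′_
infixr 5 _∨′_
infix  4 _⊨_

-- First-order logic with equality over ⟨ <, S ; min, max ⟩, with k free
-- variables in de Bruijn style: under a quantifier, variable zero is the
-- newly bound one.

data Term (k : ℕ) : Set where
  var     : Fin k → Term k
  min max : Term k

data Formula (k : ℕ) : Set where
  _<′_ _≐_  : Term k → Term k → Formula k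
  S         : Term k → Formula k
  ¬′_       : Formula k → Formula k
  _∧′_ _∨′_ : Formula k → Formula k → Formula k
  ∃′ ∀′     : Formula (suc k) → Formula k

Sentence : Set
Sentence = Formula 0

quantifiers : ∀ {k} → Formula k → ℕ
quantifiers (s <′ u) = 0
quantifiers (s ≐ u)  = 0
quantifiers (S s)    = 0
quantifiers (¬′ φ)   = quantifiers φ
quantifiers (φ ∧′ ψ) = quantifiers φ + quantifiers ψ
quantifiers (φ ∨′ ψ) = quantifiers φ + quantifiers ψ
quantifiers (∃′ φ)   = suc (quantifiers φ)
quantifiers (∀′ φ)   = suc (quantifiers φ)

record Structure : Set₁ where
  field
    Carrier   : Set
    _<ᴹ_      : Carrier → Carrier → Set
    Sᴹ        : Carrier → Set
    minᴹ maxᴹ : Carrier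

module _ (M : Structure) where
  open Structure M

  ⟦_⟧ : ∀ {k} → Term k → Vec Carrier k → Carrier
  ⟦ var i ⟧ ρ = lookup ρ i
  ⟦ min ⟧   ρ = minᴹ
  ⟦ max ⟧   ρ = maxᴹ

  Holds : ∀ {k} → Formula k → Vec Carrier k → Set
  Holds (s <′ u) ρ = ⟦ s ⟧ ρ <ᴹ ⟦ u ⟧ ρ
  Holds (s ≐ u)  ρ = ⟦ s ⟧ ρ ≡ ⟦ u ⟧ ρ
  Holds (S s)    ρ = Sᴹ (⟦ s ⟧ ρ)
  Holds (¬′ φ)   ρ = ¬ Holds φ ρ
  Holds (φ ∧′ ψ) ρ = Holds φ ρ × Holds ψ ρ
  Holds (φ ∨′ ψ) ρ = Holds φ ρ ⊎ Holds ψ ρ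
  Holds (∃′ φ)   ρ = Σ[ a ∈ Carrier ] Holds φ (a ∷ ρ)
  Holds (∀′ φ)   ρ = (a : Carrier) → Holds φ (a ∷ ρ)

_⊨_ : Structure → Sentence → Set
M ⊨ φ = Holds M φ []

-- The universe {1, …, n} is Fin n, position i being the element with
-- toℕ equal to i - 1.
𝐁 : ∀ {n} .{{_ : NonZero n}} → Vec Bool n → Structure
𝐁 {suc n} w = record
  { Carrier = Fin (suc n)
  ; _<ᴹ_    = Fin._<_
  ; Sᴹ      = λ i → lookup w i ≡ true
  ; minᴹ    = zero
  ; maxᴹ    = fromℕ n
  }

TendsToInfinity : (ℕ → ℕ) → Set
TendsToInfinity f = ∀ M → ∃[ N ] (∀ n → N ≤ n → M ≤ f n)

-- The real number log_b x is at most the rational p / d.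
log[_]_≤_/_ : ℕ → ℕ → ℕ → (d : ℕ) .{{_ : NonZero d}} → Set
log[ b ] x ≤ p / d = x ^ d ≤ b ^ p

-- The inequality of real numbers  q ≤ 3 log₃ n + log_t m + C.
-- A real number is the infimum of the rationals above it, so the inequality
-- holds exactly when  q ≤ 3 (p / d) + s / d + C  for all rational upper bounds
-- p / d of log₃ n and s / d of log_t m; a common denominator d loses nothing,
-- and for n, m ≥ 1 and t ≥ 2 the logarithms are nonnegative, so numerators in ℕ
-- suffice.  For m = 0, where log_t m is undefined, s = 0 is always allowed, so
-- the convention is log_t 0 = 0.
_≤3log₃⟨_⟩+log[_]⟨_⟩+⟨_⟩ : ℕ → ℕ → ℕ → ℕ → ℕ → Set
q ≤3log₃⟨ n ⟩+log[ t ]⟨ m ⟩+⟨ C ⟩ =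
  ∀ (d : ℕ) .{{_ : NonZero d}} (p s : ℕ) →
  log[ 3 ] n ≤ p / d → log[ t ] m ≤ s / d →
  d * q ≤ 3 * p + s + d * C

{-# OPTIONS --safe #-}
module Submission where

-- A single string w of length n is described by guessing two cut points y₁, y₂
-- of the string and letting a universally quantified z choose, by being min,
-- max or neither, which third has to be described recursively: 3⌈log₃ n⌉
-- quantifiers, in a prefix that does not depend on w. For a set A, first name t
-- elements as digits, then guess r = ⌈log_t |A|⌉ further elements among them,
-- which spell the index of a member of A in base t. The descriptions of the
-- members share their prefix, and the digits tell them apart without further
-- quantifiers, so that the disjunction over A can be taken inside the prefix.
-- The finitely many lengths n ≤ t only affect the constant.

open import Data.Bool using (Bool; true; false)
open import Data.Bool.Properties using (¬-not)
open import Data.Fin as Fin using (Fin; zero; suc; toℕ; fromℕ; inject≤; combine; _↑ˡ_)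
open import Data.Fin.Properties as Fin using
  (toℕ-injective; toℕ≤pred[n]; toℕ-inject≤; inject≤-injective; combine-surjective)
open import Data.List using (List; []; _∷_; _++_; length; replicate)
import Data.List as List
open import Data.List.Membership.Propositional using (_∈_; _∉_)
open import Data.List.Membership.Propositional.Properties using (∈-lookup)
open import Data.List.Properties using (length-++; length-replicate)
open import Data.List.Relation.Unary.Any using (here; there; index)
open import Data.List.Relation.Unary.Any.Properties using (lookup-index)
open import Data.List.Relation.Unary.Unique.Propositional using (Unique)
open import Data.Nat using (ℕ; zero; suc; _+_; _*_; _^_; _≤_; _<_; z≤n; s≤s; s≤s⁻¹; NonZero; >-nonZero⁻¹)
open import Data.Nat.Properties
open import Data.Nat.Solver using (module +-*-Solver)
open import Data.Product using (_×_; _,_; proj₁; proj₂; Σ-syntax; ∃-syntax)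
open import Data.Sum using (inj₁; inj₂; [_,_]′)
open import Data.Vec using (Vec; []; _∷_; lookup; tabulate)
import Data.Vec as Vec
open import Data.Vec.Properties using (tabulate∘lookup; tabulate-cong; lookup-++ˡ; lookup∘tabulate)
open import Function using (_∘_; case_of_; _⇔_; mk⇔; Equivalence)
open import Function.Construct.Composition using (_⇔-∘_)
open import Function.Definitions using (Injective)
open import Relation.Binary.PropositionalEquality using (_≡_; _≢_; refl; sym; trans; cong; cong₂; subst; subst₂)
open import Relation.Nullary using (¬_; yes; no; contradiction)
open import Defs

open Structure
open Equivalence using (to; from)

-- Prenex formulas with a prescribed quantifier prefix

data Quantifier : Set where
  some every : Quantifier

-- The prefix is an index of the type, so formulas with equal prefixes can be merged without adding
-- quantifiers, and the quantifier count depends on the index alone.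
data Prenex : List Quantifier → ℕ → Set where
  matrix : ∀ {k} (φ : Formula k) → quantifiers φ ≡ 0 → Prenex [] k
  bind   : ∀ {Q k} (q : Quantifier) → Prenex Q (suc k) → Prenex (q ∷ Q) k

quantify : ∀ {k} → Quantifier → Formula (suc k) → Formula k
quantify some  = ∃′
quantify every = ∀′

formula : ∀ {Q k} → Prenex Q k → Formula k
formula (matrix φ _) = φ
formula (bind q φ)   = quantify q (formula φ)

quantifiers-formula : ∀ {Q k} (φ : Prenex Q k) → quantifiers (formula φ) ≡ length Q
quantifiers-formula (matrix φ eq)  = eq
quantifiers-formula (bind some φ)  = cong suc (quantifiers-formula φ)
quantifiers-formula (bind every φ) = cong suc (quantifiers-formula φ)

HoldsP : ∀ (M : Structure) {Q k} → Prenex Q k → Vec (Carrier M) k → Set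
HoldsP M φ ρ = Holds M (formula φ) ρ

wk : ∀ {k} → Term k → Term (suc k)
wk (var i) = var (suc i)
wk min     = min
wk max     = max

⟦wk⟧ : ∀ (M : Structure) {k} (s : Term k) a (ρ : Vec (Carrier M) k) →
       ⟦ M ⟧ (wk s) (a ∷ ρ) ≡ ⟦ M ⟧ s ρ
⟦wk⟧ M (var i) a ρ = refl
⟦wk⟧ M min     a ρ = refl
⟦wk⟧ M max     a ρ = refl

quantify-cong : ∀ (M : Structure) {k} q {φ ψ : Formula (suc k)} {ρ} →
                (∀ a → Holds M φ (a ∷ ρ) ⇔ Holds M ψ (a ∷ ρ)) →
                Holds M (quantify q φ) ρ ⇔ Holds M (quantify q ψ) ρ
quantify-cong M some  eq = mk⇔ (λ (a , h) → a , to (eq a) h) (λ (a , h) → a , from (eq a) h)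
quantify-cong M every eq = mk⇔ (λ h a → to (eq a) (h a)) (λ h a → from (eq a) (h a))

-- The condition only mentions variables bound
-- outside, so both branches can share one quantifier prefix.
ite : ∀ {Q k} → Term k → Term k → Prenex Q k → Prenex Q k → Prenex Q k
ite s u (matrix φ eq) (matrix ψ eq′) =
  matrix ((s ≐ u ∧′ φ) ∨′ (¬′ (s ≐ u) ∧′ ψ)) (cong₂ _+_ eq eq′)
ite s u (bind q φ) (bind .q ψ) = bind q (ite (wk s) (wk u) φ ψ)

ite-true : ∀ (M : Structure) {Q k} s u (φ ψ : Prenex Q k) ρ → ⟦ M ⟧ s ρ ≡ ⟦ M ⟧ u ρ →
           HoldsP M (ite s u φ ψ) ρ ⇔ HoldsP M φ ρ
ite-true M s u (matrix φ _) (matrix ψ _) ρ eq =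
  mk⇔ [ proj₂ , (λ (neq , _) → contradiction eq neq) ]′ (λ h → inj₁ (eq , h))
ite-true M s u (bind q φ) (bind .q ψ) ρ eq = quantify-cong M q λ a →
  ite-true M (wk s) (wk u) φ ψ (a ∷ ρ) (trans (⟦wk⟧ M s a ρ) (trans eq (sym (⟦wk⟧ M u a ρ))))

ite-false : ∀ (M : Structure) {Q k} s u (φ ψ : Prenex Q k) ρ → ⟦ M ⟧ s ρ ≢ ⟦ M ⟧ u ρ →
            HoldsP M (ite s u φ ψ) ρ ⇔ HoldsP M ψ ρ
ite-false M s u (matrix φ _) (matrix ψ _) ρ neq =
  mk⇔ [ (λ (eq , _) → contradiction eq neq) , proj₂ ]′ (λ h → inj₂ (neq , h))
ite-false M s u (bind q φ) (bind .q ψ) ρ neq = quantify-cong M q λ a →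
  ite-false M (wk s) (wk u) φ ψ (a ∷ ρ)
    (λ eq → neq (trans (sym (⟦wk⟧ M s a ρ)) (trans eq (⟦wk⟧ M u a ρ))))

-- Under a universal quantifier this acts as a conjunction of three formulas that share one prefix,
-- provided the structure has an element other than `min` and `max`.
split : ∀ {Q k} (φ₁ φ₂ φ₃ : Prenex Q (suc k)) → Prenex Q (suc k)
split φ₁ φ₂ φ₃ = ite (var zero) min φ₁ (ite (var zero) max φ₂ φ₃)

split-min : ∀ (M : Structure) {Q k} (φ₁ φ₂ φ₃ : Prenex Q (suc k)) a ρ → a ≡ minᴹ M →
            HoldsP M (split φ₁ φ₂ φ₃) (a ∷ ρ) ⇔ HoldsP M φ₁ (a ∷ ρ)
split-min M φ₁ φ₂ φ₃ a ρ = ite-true M (var zero) min φ₁ (ite (var zero) max φ₂ φ₃) (a ∷ ρ)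

split-max : ∀ (M : Structure) {Q k} (φ₁ φ₂ φ₃ : Prenex Q (suc k)) a ρ → a ≢ minᴹ M → a ≡ maxᴹ M →
            HoldsP M (split φ₁ φ₂ φ₃) (a ∷ ρ) ⇔ HoldsP M φ₂ (a ∷ ρ)
split-max M φ₁ φ₂ φ₃ a ρ neq eq =
  ite-true M (var zero) max φ₂ φ₃ (a ∷ ρ) eq
  ⇔-∘ ite-false M (var zero) min φ₁ (ite (var zero) max φ₂ φ₃) (a ∷ ρ) neq

split-mid : ∀ (M : Structure) {Q k} (φ₁ φ₂ φ₃ : Prenex Q (suc k)) a ρ → a ≢ minᴹ M → a ≢ maxᴹ M →
            HoldsP M (split φ₁ φ₂ φ₃) (a ∷ ρ) ⇔ HoldsP M φ₃ (a ∷ ρ)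
split-mid M φ₁ φ₂ φ₃ a ρ neq neq′ =
  ite-false M (var zero) max φ₂ φ₃ (a ∷ ρ) neq′
  ⇔-∘ ite-false M (var zero) min φ₁ (ite (var zero) max φ₂ φ₃) (a ∷ ρ) neq

-- Strings and positions

Word : ℕ → Set
Word = Vec Bool

-- Positions beyond the end are clipped to the last one.
pos : ∀ {n} → ℕ → Fin (suc n)
pos {zero}  _       = zero
pos {suc n} zero    = zero
pos {suc n} (suc i) = suc (pos i)

pos-zero : ∀ n → pos {n} 0 ≡ zero
pos-zero zero    = refl
pos-zero (suc n) = refl

pos-toℕ : ∀ {n} (x : Fin (suc n)) → pos (toℕ x) ≡ x
pos-toℕ {zero}  zero    = refl
pos-toℕ {suc n} zero    = refl
pos-toℕ {suc n} (suc x) = cong suc (pos-toℕ x)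

pos-max : ∀ {n i} → n ≤ i → pos i ≡ fromℕ n
pos-max {zero}  z≤n       = refl
pos-max {suc n} (s≤s n≤i) = cong suc (pos-max n≤i)

pos-mono : ∀ n i → toℕ (pos {n} i) ≤ toℕ (pos {n} (suc i))
pos-mono zero    i       = z≤n
pos-mono (suc n) zero    = z≤n
pos-mono (suc n) (suc i) = s≤s (pos-mono n i)

pos-suc : ∀ n i → toℕ (pos {n} (suc i)) ≤ suc (toℕ (pos {n} i))
pos-suc zero    i       = z≤n
pos-suc (suc n) zero    = s≤s (≤-reflexive (cong toℕ (pos-zero n)))
pos-suc (suc n) (suc i) = s≤s (pos-suc n i)

pos-< : ∀ {n i} → i < n → toℕ (pos {n} i) < toℕ (pos {n} (suc i))
pos-< {suc n} {zero}  _         = s≤s z≤n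
pos-< {suc n} {suc i} (s≤s i<n) = s≤s (pos-< i<n)

Agree : ∀ {n} → Word (suc n) → Word (suc n) → ℕ → Set
Agree v w i = lookup v (pos i) ≡ lookup w (pos i)

agree⇒≡ : ∀ {n} {v w : Word (suc n)} → (∀ i → i ≤ n → Agree v w i) → v ≡ w
agree⇒≡ {v = v} {w} h = trans (sym (tabulate∘lookup v)) (trans (tabulate-cong eq) (tabulate∘lookup w))
  where
  eq : ∀ x → lookup v x ≡ lookup w x
  eq x = subst (λ y → lookup v y ≡ lookup w y) (pos-toℕ x) (h (toℕ x) (toℕ≤pred[n] x))

literal : ∀ {k} → Bool → Term k → Formula k
literal true  s = S s
literal false s = ¬′ S s

quantifiers-literal : ∀ {k} b (s : Term k) → quantifiers (literal b s) ≡ 0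
quantifiers-literal true  s = refl
quantifiers-literal false s = refl

literal⇔ : ∀ {n} (v : Word (suc n)) {k} b (s : Term k) ρ →
           Holds (𝐁 v) (literal b s) ρ ⇔ (lookup v (⟦ 𝐁 v ⟧ s ρ) ≡ b)
literal⇔ v true  s ρ = mk⇔ (λ h → h) (λ h → h)
literal⇔ v false s ρ = mk⇔ ¬-not (λ eq eq′ → case trans (sym eq) eq′ of λ ())

-- Describing a string with prefix (∃∃∀)ᵏ

-- The right end of a stretch of length `3 ^ k` that starts at `p`. Iteration makes the ends of the
-- three parts agree definitionally with the ends of the whole.
end : ℕ → ℕ → ℕ
end zero    p = suc p
end (suc k) p = end k (end k (end k p))

end≡ : ∀ k p → end k p ≡ 3 ^ k + p
end≡ zero    p = refl
end≡ (suc k) p rewrite end≡ k (end k (end k p)) | end≡ k (end k p) | end≡ k p =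
  solve 2 (λ x y → x :+ (x :+ (x :+ y)) := (x :+ (x :+ (x :+ con 0))) :+ y) refl (3 ^ k) p
  where open +-*-Solver

ternary : ℕ → List Quantifier
ternary zero    = []
ternary (suc k) = some ∷ some ∷ every ∷ ternary k

length-ternary : ∀ k → length (ternary k) ≡ 3 * k
length-ternary zero    = refl
length-ternary (suc k) = trans (cong (3 +_) (length-ternary k)) (sym (*-suc 3 k))

-- Past the end of the string both positions are clipped to the last one and their distance is 0;
-- then only `s` ≤ `u` may be demanded.
step : ∀ {n k} (i j : Fin n) → Term k → Term k → Formula k
step i j s u with i Fin.≟ j
... | yes _ = ¬′ (u <′ s)
... | no  _ = s <′ u

quantifiers-step : ∀ {n k} (i j : Fin n) (s u : Term k) → quantifiers (step i j s u) ≡ 0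
quantifiers-step i j s u with i Fin.≟ j
... | yes _ = refl
... | no  _ = refl

y₁ y₂ : ∀ {c} → Term (3 + c)
y₁ = var (suc (suc zero))
y₂ = var (suc zero)

-- Says of s and u that they are at least as far apart as positions p and
-- end k p and, if they are these positions, that the string between them is
-- the one in w. Only lower bounds are needed on distances, because the total
-- length is fixed.
segment : ∀ {n} → Word (suc n) → ∀ k → ℕ → ∀ {c} → Term c → Term c → Prenex (ternary k) c
segment {n} w zero p s u = matrix
  (step (pos {n} p) (pos (suc p)) s u ∧′ literal (lookup w (pos p)) s ∧′ literal (lookup w (pos (suc p))) u)
  (cong₂ _+_ (quantifiers-step (pos {n} p) (pos (suc p)) s u)
    (cong₂ _+_ (quantifiers-literal (lookup w (pos p)) s) (quantifiers-literal (lookup w (pos (suc p))) u)))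
segment w (suc k) p s u = bind some (bind some (bind every (split
  (segment w k p (wk (wk (wk s))) y₁)
  (segment w k (end k p) y₁ y₂)
  (segment w k (end k (end k p)) y₂ (wk (wk (wk u)))))))

⟦wk³⟧ : ∀ (M : Structure) {c} (s : Term c) a a′ a″ (ρ : Vec (Carrier M) c) →
        ⟦ M ⟧ (wk (wk (wk s))) (a ∷ a′ ∷ a″ ∷ ρ) ≡ ⟦ M ⟧ s ρ
⟦wk³⟧ M s a a′ a″ ρ = trans (⟦wk⟧ M (wk (wk s)) a _) (trans (⟦wk⟧ M (wk s) a′ _) (⟦wk⟧ M s a″ ρ))

segment-complete : ∀ {n} (w : Word (suc n)) k p {c} (s u : Term c) ρ →
                   ⟦ 𝐁 w ⟧ s ρ ≡ pos p → ⟦ 𝐁 w ⟧ u ρ ≡ pos (end k p) → HoldsP (𝐁 w) (segment w k p s u) ρ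
segment-complete {n} w zero p s u ρ eqs equ =
  stepHolds ,
  from (literal⇔ w _ s ρ) (cong (lookup w) eqs) ,
  from (literal⇔ w _ u ρ) (cong (lookup w) equ)
  where
  stepHolds : Holds (𝐁 w) (step (pos {n} p) (pos (suc p)) s u) ρ
  stepHolds with pos {n} p Fin.≟ pos (suc p)
  ... | yes eq = λ lt → <-irrefl (cong toℕ (trans equ (trans (sym eq) (sym eqs)))) lt
  ... | no neq = subst₂ Fin._<_ (sym eqs) (sym equ) (Fin.≤∧≢⇒< (pos-mono n p) neq)
segment-complete w (suc k) p s u ρ eqs equ =
  -- The guessed cut points are the intended ones.
  pos p₁ , pos p₂ , third
  where
  p₁ = end k p
  p₂ = end k p₁
  φ₁ = segment w k p (wk (wk (wk s))) y₁
  φ₂ = segment w k p₁ y₁ y₂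
  φ₃ = segment w k p₂ y₂ (wk (wk (wk u)))
  third : ∀ a → HoldsP (𝐁 w) (split φ₁ φ₂ φ₃) (a ∷ pos p₂ ∷ pos p₁ ∷ ρ)
  third a with a Fin.≟ zero
  ... | yes eq = from (split-min (𝐁 w) φ₁ φ₂ φ₃ a _ eq)
    (segment-complete w k p (wk (wk (wk s))) y₁ _ (trans (⟦wk³⟧ (𝐁 w) s _ _ _ ρ) eqs) refl)
  ... | no neq with a Fin.≟ fromℕ _
  ...   | yes eq = from (split-max (𝐁 w) φ₁ φ₂ φ₃ a _ neq eq) (segment-complete w k p₁ y₁ y₂ _ refl refl)
  ...   | no neq′ = from (split-mid (𝐁 w) φ₁ φ₂ φ₃ a _ neq neq′)
    (segment-complete w k p₂ y₂ (wk (wk (wk u))) _ refl (trans (⟦wk³⟧ (𝐁 w) u _ _ _ ρ) equ))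

-- d(x , x′) ≤ d(a , b), with both sides moved so that no subtraction occurs.
Far : ∀ {n} (x x′ a b : Fin n) → Set
Far x x′ a b = toℕ x′ + toℕ a ≤ toℕ b + toℕ x

-- Lower bounds on distances add up: in the sum of the two inequalities the middle terms `x′` and
-- `b` occur on both sides and cancel.
far-trans : ∀ {n} (x x′ x″ a b c : Fin n) → Far x x′ a b → Far x′ x″ b c → Far x x″ a c
far-trans x x′ x″ a b c h h′ = +-cancelˡ-≤ (toℕ x′ + toℕ b) _ _ (begin
  toℕ x′ + toℕ b + (toℕ x″ + toℕ a)   ≡⟨ shuffle (toℕ x′) (toℕ b) (toℕ x″) (toℕ a) ⟩
  (toℕ x′ + toℕ a) + (toℕ x″ + toℕ b) ≤⟨ +-mono-≤ h h′ ⟩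
  (toℕ b + toℕ x) + (toℕ c + toℕ x′)  ≡⟨ shuffle′ (toℕ b) (toℕ x) (toℕ c) (toℕ x′) ⟩
  toℕ x′ + toℕ b + (toℕ c + toℕ x)    ∎)
  where
  open ≤-Reasoning
  open +-*-Solver
  shuffle : ∀ p q r s → p + q + (r + s) ≡ (p + s) + (r + q)
  shuffle = solve 4 (λ p q r s → p :+ q :+ (r :+ s) := (p :+ s) :+ (r :+ q)) refl
  shuffle′ : ∀ p q r s → (p + q) + (r + s) ≡ s + p + (r + q)
  shuffle′ = solve 4 (λ p q r s → (p :+ q) :+ (r :+ s) := s :+ p :+ (r :+ q)) refl

-- With the outer elements in place, the left bound gives `x′` ≤ `b` and the right bound gives `b` ≤
-- `x′`.
far-squeeze : ∀ {n} (x x′ x″ b : Fin n) → Far x x′ x b → Far x′ x″ b x″ → b ≡ x′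
far-squeeze x x′ x″ b h h′ = toℕ-injective (≤-antisym
  (+-cancelˡ-≤ (toℕ x″) _ _ h′)
  (+-cancelʳ-≤ (toℕ x) _ _ h))

-- A third element besides min and max is needed for the universal quantifier
-- to reach all three parts, hence the length 3 + m.
segment-sound : ∀ {m} (v w : Word (3 + m)) k p {c} (s u : Term c) ρ → HoldsP (𝐁 v) (segment w k p s u) ρ →
  Far (pos p) (pos (end k p)) (⟦ 𝐁 v ⟧ s ρ) (⟦ 𝐁 v ⟧ u ρ)
  × (⟦ 𝐁 v ⟧ s ρ ≡ pos p → ⟦ 𝐁 v ⟧ u ρ ≡ pos (end k p) → ∀ i → p ≤ i → i ≤ end k p → Agree v w i)
segment-sound {m} v w zero p s u ρ (hstep , hs , hu) = far , agree
  where
  far : Far (pos p) (pos (suc p)) (⟦ 𝐁 v ⟧ s ρ) (⟦ 𝐁 v ⟧ u ρ)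
  far with pos {2 + m} p Fin.≟ pos (suc p)
  ... | yes eq = ≤-trans (+-mono-≤ (≤-reflexive (cong toℕ (sym eq))) (≮⇒≥ hstep))
                   (≤-reflexive (+-comm (toℕ (pos {2 + m} p)) _))
  ... | no _   = ≤-trans (+-monoˡ-≤ (toℕ (⟦ 𝐁 v ⟧ s ρ)) (pos-suc (2 + m) p))
                   (≤-trans (≤-reflexive (sym (+-suc (toℕ (pos {2 + m} p)) _)))
                   (≤-trans (+-monoʳ-≤ (toℕ (pos {2 + m} p)) hstep) (≤-reflexive (+-comm (toℕ (pos {2 + m} p)) _))))
  agree : _ → _ → ∀ i → p ≤ i → i ≤ suc p → Agree v w i
  agree eqs equ i p≤i i≤p+1 with m≤n⇒m<n∨m≡n p≤i
  ... | inj₂ refl = trans (cong (lookup v) (sym eqs)) (to (literal⇔ v _ s ρ) hs)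
  ... | inj₁ p<i with ≤-antisym i≤p+1 p<i
  ...   | refl = trans (cong (lookup v) (sym equ)) (to (literal⇔ v _ u ρ) hu)
segment-sound {m} v w (suc k) p s u ρ (b₁ , b₂ , h) = far , agree
  where
  p₁ = end k p
  p₂ = end k p₁
  p₃ = end k p₂
  a = ⟦ 𝐁 v ⟧ s ρ
  b = ⟦ 𝐁 v ⟧ u ρ
  φ₁ = segment w k p (wk (wk (wk s))) y₁
  φ₂ = segment w k p₁ y₁ y₂
  φ₃ = segment w k p₂ y₂ (wk (wk (wk u)))
  -- Instantiating the universal variable at `min`, at `max` and at the second position, which is
  -- neither, yields the three parts.
  ih₁ = segment-sound v w k p (wk (wk (wk s))) y₁ (zero ∷ b₂ ∷ b₁ ∷ ρ)
    (to (split-min (𝐁 v) φ₁ φ₂ φ₃ zero _ refl) (h zero))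
  ih₂ = segment-sound v w k p₁ y₁ y₂ (fromℕ _ ∷ b₂ ∷ b₁ ∷ ρ)
    (to (split-max (𝐁 v) φ₁ φ₂ φ₃ (fromℕ _) _ (λ ()) refl) (h (fromℕ _)))
  ih₃ = segment-sound v w k p₂ y₂ (wk (wk (wk u))) (suc zero ∷ b₂ ∷ b₁ ∷ ρ)
    (to (split-mid (𝐁 v) φ₁ φ₂ φ₃ (suc zero) _ (λ ()) (λ ())) (h (suc zero)))
  far₁ : Far (pos p) (pos p₁) a b₁
  far₁ = subst (λ x → Far (pos p) (pos p₁) x b₁) (⟦wk³⟧ (𝐁 v) s _ _ _ ρ) (proj₁ ih₁)
  far₂ : Far (pos p₁) (pos p₂) b₁ b₂
  far₂ = proj₁ ih₂
  far₃ : Far (pos p₂) (pos p₃) b₂ b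
  far₃ = subst (λ x → Far (pos p₂) (pos p₃) b₂ x) (⟦wk³⟧ (𝐁 v) u _ _ _ ρ) (proj₁ ih₃)
  far₁₂ : Far (pos p) (pos p₂) a b₂
  far₁₂ = far-trans (pos p) (pos p₁) (pos p₂) a b₁ b₂ far₁ far₂
  far₂₃ : Far (pos p₁) (pos p₃) b₁ b
  far₂₃ = far-trans (pos p₁) (pos p₂) (pos p₃) b₁ b₂ b far₂ far₃
  far : Far (pos p) (pos p₃) a b
  far = far-trans (pos p) (pos p₁) (pos p₃) a b₁ b far₁ far₂₃
  agree : a ≡ pos p → b ≡ pos p₃ → ∀ i → p ≤ i → i ≤ p₃ → Agree v w i
  agree eqa eqb i p≤i i≤p₃ = part
    where
    -- Each cut point is pinned by the total distance bounds on its two sides, so the agreement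
    -- claims of all three parts become applicable.
    eq₁ : b₁ ≡ pos p₁
    eq₁ = far-squeeze (pos p) (pos p₁) (pos p₃) b₁
      (subst (λ x → Far (pos p) (pos p₁) x b₁) eqa far₁) (subst (Far (pos p₁) (pos p₃) b₁) eqb far₂₃)
    eq₂ : b₂ ≡ pos p₂
    eq₂ = far-squeeze (pos p) (pos p₂) (pos p₃) b₂
      (subst (λ x → Far (pos p) (pos p₂) x b₂) eqa far₁₂) (subst (Far (pos p₂) (pos p₃) b₂) eqb far₃)
    part : Agree v w i
    part with ≤-total i p₁ | ≤-total i p₂
    ... | inj₁ i≤p₁ | _         = proj₂ ih₁ (trans (⟦wk³⟧ (𝐁 v) s _ _ _ ρ) eqa) eq₁ i p≤i i≤p₁
    ... | inj₂ p₁≤i | inj₁ i≤p₂ = proj₂ ih₂ eq₁ eq₂ i p₁≤i i≤p₂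
    ... | inj₂ _    | inj₂ p₂≤i = proj₂ ih₃ eq₂ (trans (⟦wk³⟧ (𝐁 v) u _ _ _ ρ) eqb) i p₂≤i i≤p₃

describe : ∀ {n} k → Word (suc n) → ∀ {c} → Prenex (ternary k) c
describe k w = segment w k 0 min max

-- Since `3 ^ k` is at least the length, `end k 0` is clipped to the last position, so `min` and
-- `max` denote exactly the two ends of the segment.
describe⇔ : ∀ {m} (v w : Word (3 + m)) k → 3 + m ≤ 3 ^ k → ∀ {c} (ρ : Vec _ c) →
            HoldsP (𝐁 v) (describe k w) ρ ⇔ v ≡ w
describe⇔ {m} v w k n≤3ᵏ ρ = mk⇔
  (λ h → agree⇒≡ λ i i≤ → proj₂ (segment-sound v w k 0 min max ρ h) refl (sym last) i z≤n (≤-trans i≤ bound))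
  (λ { refl → segment-complete v k 0 min max ρ refl (sym last) })
  where
  bound : 2 + m ≤ end k 0
  bound = ≤-trans (<⇒≤ n≤3ᵏ) (≤-reflexive (sym (trans (end≡ k 0) (+-identityʳ _))))
  last : pos (end k 0) ≡ fromℕ (2 + m)
  last = pos-max bound

-- Choosing a member of a family by its digits

-- The last branch is an untested default, so some branch is taken whatever value `z` has.
switch : ∀ {Q k t} → Term k → (Fin (suc t) → Term k) → (Fin (suc t) → Prenex Q k) → Prenex Q k
switch {t = zero}  z c φ = φ zero
switch {t = suc t} z c φ = ite z (c zero) (φ zero) (switch z (c ∘ suc) (φ ∘ suc))

switch-sound : ∀ {n} (v : Word (suc n)) {Q k t} z c (φ : Fin (suc t) → Prenex Q k) ρ →
               HoldsP (𝐁 v) (switch z c φ) ρ → ∃[ j ] HoldsP (𝐁 v) (φ j) ρ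
switch-sound v {t = zero}  z c φ ρ h = zero , h
switch-sound v {t = suc t} z c φ ρ h with ⟦ 𝐁 v ⟧ z ρ Fin.≟ ⟦ 𝐁 v ⟧ (c zero) ρ
... | yes eq = zero , to (ite-true (𝐁 v) z (c zero) (φ zero) (switch z (c ∘ suc) (φ ∘ suc)) ρ eq) h
... | no neq with switch-sound v z (c ∘ suc) (φ ∘ suc) ρ
                    (to (ite-false (𝐁 v) z (c zero) (φ zero) (switch z (c ∘ suc) (φ ∘ suc)) ρ neq) h)
...   | j , h′ = suc j , h′

switch-complete : ∀ (M : Structure) {Q k t} z c (φ : Fin (suc t) → Prenex Q k) ρ →
                  Injective _≡_ _≡_ (λ j → ⟦ M ⟧ (c j) ρ) →
                  ∀ j → ⟦ M ⟧ z ρ ≡ ⟦ M ⟧ (c j) ρ → HoldsP M (φ j) ρ → HoldsP M (switch z c φ) ρ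
switch-complete M {t = zero}  z c φ ρ inj zero    eq h = h
switch-complete M {t = suc t} z c φ ρ inj zero    eq h =
  from (ite-true M z (c zero) (φ zero) (switch z (c ∘ suc) (φ ∘ suc)) ρ eq) h
-- Injectivity makes the test against the earlier digit fail.
switch-complete M {t = suc t} z c φ ρ inj (suc j) eq h =
  from (ite-false M z (c zero) (φ zero) (switch z (c ∘ suc) (φ ∘ suc)) ρ
         (λ eq′ → case inj (trans (sym eq) eq′) of λ ()))
    (switch-complete M z (c ∘ suc) (φ ∘ suc) ρ (Fin.suc-injective ∘ inj) j eq h)

-- Guesses the base `suc t` digits of an index, most significant first. `φ` is polymorphic in its
-- context because it ends up below the `r` guessed variables.
select : ∀ {Q t} r {k} → (Fin (suc t) → Term k) → (Fin (suc t ^ r) → ∀ {c} → Prenex Q c) →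
         Prenex (replicate r some ++ Q) k
select zero    c φ = φ zero
select (suc r) c φ = bind some (switch (var zero) (wk ∘ c) λ j → select r (wk ∘ c) λ i → φ (combine j i))

select-sound : ∀ {n} (v : Word (suc n)) {Q t} r {k} c (φ : Fin (suc t ^ r) → ∀ {c} → Prenex Q c) (ρ : Vec _ k) →
               HoldsP (𝐁 v) (select r c φ) ρ → ∃[ i ] ∃[ k′ ] Σ[ ρ′ ∈ Vec _ k′ ] HoldsP (𝐁 v) (φ i) ρ′
select-sound v zero    c φ ρ h = zero , _ , ρ , h
select-sound v (suc r) c φ ρ (a , h) with switch-sound v _ (wk ∘ c) _ (a ∷ ρ) h
... | j , h′ with select-sound v r (wk ∘ c) _ (a ∷ ρ) h′
...   | i , res = combine j i , res

select-complete : ∀ (M : Structure) {Q t} r {k} c (φ : Fin (suc t ^ r) → ∀ {c} → Prenex Q c) (ρ : Vec _ k) →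
                  Injective _≡_ _≡_ (λ j → ⟦ M ⟧ (c j) ρ) →
                  ∀ i → (∀ {k′} (ρ′ : Vec _ k′) → HoldsP M (φ i) ρ′) → HoldsP M (select r c φ) ρ
select-complete M zero    c φ ρ inj zero h = h ρ
select-complete M {t = t} (suc r) c φ ρ inj i h with combine-surjective {suc t} i
... | j , i′ , refl = a , switch-complete M _ (wk ∘ c) _ (a ∷ ρ) inj′ j (sym (⟦wk⟧ M (c j) a ρ))
                            (select-complete M r (wk ∘ c) _ (a ∷ ρ) inj′ i′ h)
  where
  a = ⟦ M ⟧ (c j) ρ
  inj′ : Injective _≡_ _≡_ (λ j → ⟦ M ⟧ (wk (c j)) (a ∷ ρ))
  inj′ eq = inj (trans (sym (⟦wk⟧ M (c _) a ρ)) (trans eq (⟦wk⟧ M (c _) a ρ)))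

-- Blocks of existential quantifiers

exists : ∀ t {k} → Formula (t + k) → Formula k
exists zero    φ = φ
exists (suc t) φ = exists t (∃′ φ)

quantifiers-exists : ∀ t {k} (φ : Formula (t + k)) → quantifiers (exists t φ) ≡ t + quantifiers φ
quantifiers-exists zero    φ = refl
quantifiers-exists (suc t) φ = trans (quantifiers-exists t (∃′ φ)) (+-suc t _)

exists-sound : ∀ (M : Structure) t {k} (φ : Formula (t + k)) ρ →
               Holds M (exists t φ) ρ → Σ[ xs ∈ Vec (Carrier M) t ] Holds M φ (xs Vec.++ ρ)
exists-sound M zero    φ ρ h = [] , h
exists-sound M (suc t) φ ρ h with exists-sound M t (∃′ φ) ρ h
... | xs , a , h′ = a ∷ xs , h′

exists-complete : ∀ (M : Structure) t {k} (φ : Formula (t + k)) ρ xs →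
                  Holds M φ (xs Vec.++ ρ) → Holds M (exists t φ) ρ
exists-complete M zero    φ ρ []       h = h
exists-complete M (suc t) φ ρ (a ∷ xs) h = exists-complete M t (∃′ φ) ρ xs (a , h)

-- Strings with enough positions for the digits

-- The digits are not required to be distinct: soundness holds for any choice,
-- and only the choice made for w ∈ A has to be injective.
module _ {m : ℕ} (t r k : ℕ) (x : Word (3 + m)) (xs : List (Word (3 + m))) where

  -- Surplus indices are clipped to the last list entry, so every digit sequence describes some
  -- member of the set.
  member : Fin (suc t ^ r) → ∀ {c} → Prenex (ternary k) c
  member i = describe k (List.lookup (x ∷ xs) (pos (toℕ i)))

  digit : Fin (suc t) → Term (suc t + 0)
  digit j = var (j ↑ˡ 0)

  spell : Prenex (replicate r some ++ ternary k) (suc t + 0)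
  spell = select r digit member

  longSentence : Sentence
  longSentence = exists (suc t) (formula spell)

  quantifiers-long : quantifiers longSentence ≡ suc t + (r + 3 * k)
  quantifiers-long = trans (quantifiers-exists (suc t) (formula spell)) (cong (suc t +_)
    (trans (quantifiers-formula spell) (trans (length-++ (replicate r some))
      (cong₂ _+_ (length-replicate r) (length-ternary k)))))

  long-complete : 3 + m ≤ 3 ^ k → length (x ∷ xs) ≤ suc t ^ r → suc t ≤ 3 + m →
                  ∀ w → w ∈ x ∷ xs → 𝐁 w ⊨ longSentence
  long-complete n≤ len≤ t≤ w w∈ = exists-complete (𝐁 w) (suc t) _ [] ys
    (select-complete (𝐁 w) r digit member (ys Vec.++ []) inj i λ ρ → from (describe⇔ w _ k n≤ ρ) eq)
    where
    -- The first `suc t` positions of the string serve as digits; they exist by `t≤`.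
    ys : Vec (Fin (3 + m)) (suc t)
    ys = tabulate (λ j → inject≤ j t≤)
    val : ∀ j → lookup (ys Vec.++ []) (j ↑ˡ 0) ≡ inject≤ j t≤
    val j = trans (lookup-++ˡ ys [] j) (lookup∘tabulate (λ i → inject≤ i t≤) j)
    inj : Injective _≡_ _≡_ (λ j → lookup (ys Vec.++ []) (j ↑ˡ 0))
    inj {j} {j′} e = inject≤-injective t≤ t≤ j j′ (trans (sym (val j)) (trans e (val j′)))
    i : Fin (suc t ^ r)
    i = inject≤ (index w∈) len≤
    eq : w ≡ List.lookup (x ∷ xs) (pos (toℕ i))
    eq = trans (lookup-index w∈) (cong (List.lookup (x ∷ xs))
           (sym (trans (cong pos (toℕ-inject≤ (index w∈) len≤)) (pos-toℕ (index w∈)))))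

  long-sound : 3 + m ≤ 3 ^ k → ∀ w → 𝐁 w ⊨ longSentence → w ∈ x ∷ xs
  long-sound n≤ w h with exists-sound (𝐁 w) (suc t) _ [] h
  ... | ys , h′ with select-sound w r digit member _ h′
  ...   | i , _ , ρ , h″ = subst (_∈ x ∷ xs) (sym (to (describe⇔ w _ k n≤ ρ) h″))
                             (∈-lookup {xs = x ∷ xs} (pos (toℕ i)))

-- Strings of bounded length

chain : ∀ {n} → Word (suc n) → ℕ → ∀ {c} → Term c → Formula c
chain w zero    s = literal (lookup w (pos 0)) s
chain w (suc p) s = literal (lookup w (pos (suc p))) s ∧′ ∃′ (var zero <′ wk s ∧′ chain w p (var zero))

quantifiers-chain : ∀ {n} (w : Word (suc n)) p {c} (s : Term c) → quantifiers (chain w p s) ≡ p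
quantifiers-chain w zero    s = quantifiers-literal (lookup w (pos 0)) s
quantifiers-chain w (suc p) s =
  cong₂ _+_ (quantifiers-literal (lookup w (pos (suc p))) s) (cong suc (quantifiers-chain w p (var zero)))

chain-complete : ∀ {n} (w : Word (suc n)) p → p ≤ n → ∀ {c} (s : Term c) ρ →
                 ⟦ 𝐁 w ⟧ s ρ ≡ pos p → Holds (𝐁 w) (chain w p s) ρ
chain-complete w zero    p≤n s ρ eq = from (literal⇔ w _ s ρ) (cong (lookup w) eq)
chain-complete w (suc p) p<n s ρ eq =
  from (literal⇔ w _ s ρ) (cong (lookup w) eq) ,
  pos p ,
  subst (pos p Fin.<_) (sym (trans (⟦wk⟧ (𝐁 w) s _ ρ) eq)) (pos-< p<n) ,
  chain-complete w p (<⇒≤ p<n) (var zero) _ refl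

-- Strict descent forces `s` to position `p` or later. If it is exactly at `p`, the next element has
-- no room and must be at the preceding position, and so on down to the start.
chain-sound : ∀ {n} (v w : Word (suc n)) p {c} (s : Term c) ρ → Holds (𝐁 v) (chain w p s) ρ →
              pos {n} p Fin.≤ ⟦ 𝐁 v ⟧ s ρ × (⟦ 𝐁 v ⟧ s ρ ≡ pos p → ∀ i → i ≤ p → Agree v w i)
chain-sound {n} v w zero s ρ h =
  ≤-trans (≤-reflexive (cong toℕ (pos-zero n))) z≤n ,
  λ { eq zero z≤n → trans (cong (lookup v) (sym eq)) (to (literal⇔ v _ s ρ) h) }
chain-sound {n} v w (suc p) s ρ (h , y , y<wk , hy) = ≤-trans (pos-suc n p) (≤-trans (s≤s (proj₁ ih)) y<a) , agree
  where
  ih = chain-sound v w p (var zero) (y ∷ ρ) hy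
  y<a : y Fin.< ⟦ 𝐁 v ⟧ s ρ
  y<a = subst (y Fin.<_) (⟦wk⟧ (𝐁 v) s y ρ) y<wk
  agree : ⟦ 𝐁 v ⟧ s ρ ≡ pos (suc p) → ∀ i → i ≤ suc p → Agree v w i
  agree eq i i≤ with m≤n⇒m<n∨m≡n i≤
  ... | inj₁ i<   = proj₂ ih (Fin.≤-antisym y≤ (proj₁ ih)) i (s≤s⁻¹ i<)
    where y≤ = s≤s⁻¹ (≤-trans (subst (y Fin.<_) eq y<a) (pos-suc n p))
  ... | inj₂ refl = trans (cong (lookup v) (sym eq)) (to (literal⇔ v _ s ρ) h)

shortSentence : ∀ {n} → List (Word (suc n)) → Sentence
-- A quantifier-free falsehood for the empty disjunction.
shortSentence []               = min <′ min
shortSentence {n} (w ∷ A) = chain w n max ∨′ shortSentence A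

quantifiers-short : ∀ {n} (A : List (Word (suc n))) → quantifiers (shortSentence A) ≡ length A * n
quantifiers-short []      = refl
quantifiers-short (w ∷ A) = cong₂ _+_ (quantifiers-chain w _ max) (quantifiers-short A)

short-complete : ∀ {n} (A : List (Word (suc n))) w → w ∈ A → 𝐁 w ⊨ shortSentence A
short-complete (_ ∷ A) w (here refl) = inj₁ (chain-complete w _ ≤-refl max [] (sym (pos-max ≤-refl)))
short-complete (_ ∷ A) w (there w∈)  = inj₂ (short-complete A w w∈)

short-sound : ∀ {n} (A : List (Word (suc n))) w → 𝐁 w ⊨ shortSentence A → w ∈ A
short-sound []      w ()
short-sound (x ∷ A) w (inj₁ h) = here (agree⇒≡ (proj₂ (chain-sound w x _ max [] h) (sym (pos-max ≤-refl))))
short-sound (x ∷ A) w (inj₂ h) = there (short-sound A w h)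

-- The quantifier bound

sumUpTo : (ℕ → ℕ) → ℕ → ℕ
sumUpTo g zero    = g 0
sumUpTo g (suc N) = g (suc N) + sumUpTo g N

≤sumUpTo : ∀ g {n N} → n ≤ N → g n ≤ sumUpTo g N
≤sumUpTo g {N = zero}  z≤n = ≤-refl
≤sumUpTo g {N = suc N} n≤ with m≤n⇒m<n∨m≡n n≤
... | inj₁ n< = ≤-trans (≤sumUpTo g (s≤s⁻¹ n<)) (m≤n+m _ _)
... | inj₂ refl = m≤m+n _ _

-- Induction on `x`: the exponent grows exactly when `suc x` is already the power reached. The
-- second inequality expresses that rounding up costs at most 1.
⌈log⌉ : ∀ b → 2 ≤ b → ∀ x → ∃[ k ] (suc x ≤ b ^ k × b ^ k ≤ b * suc x)
⌈log⌉ b 2≤b zero    = 0 , ≤-refl , ≤-trans (<⇒≤ 2≤b) (≤-reflexive (sym (*-identityʳ b)))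
⌈log⌉ b 2≤b (suc x) with ⌈log⌉ b 2≤b x
... | k , lo , hi with m≤n⇒m<n∨m≡n lo
...   | inj₁ lt = k , lt , ≤-trans hi (*-monoʳ-≤ b (n≤1+n _))
...   | inj₂ eq = suc k ,
  ≤-trans (s≤s (m≤n+m (suc x) x)) (≤-trans (≤-reflexive (cong (suc x +_) (sym (+-identityʳ (suc x)))))
    (≤-trans (*-monoˡ-≤ (suc x) 2≤b) (≤-reflexive (cong (b *_) eq)))) ,
  ≤-trans (≤-reflexive (cong (b *_) (sym eq))) (*-monoʳ-≤ b (n≤1+n _))

^-cancelʳ-≤ : ∀ b → 2 ≤ b → ∀ {p q} → b ^ p ≤ b ^ q → p ≤ q
^-cancelʳ-≤ b 2≤b h = ≮⇒≥ λ q<p → ≤⇒≯ h (^-monoʳ-< b 2≤b q<p)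

*-^-distribʳ : ∀ x y d → (x * y) ^ d ≡ x ^ d * y ^ d
*-^-distribʳ x y zero    = refl
*-^-distribʳ x y (suc d) = trans (cong (x * y *_) (*-^-distribʳ x y d))
  (solve 4 (λ x y p q → x :* y :* (p :* q) := x :* p :* (y :* q)) refl x y (x ^ d) (y ^ d))
  where open +-*-Solver

-- This is `k` ≤ 1 + `p / d` for every rational upper bound `p / d` of the logarithm, obtained by
-- comparing exponents after raising to the power `d`.
⌈log⌉-bound : ∀ b → 2 ≤ b → ∀ {x k} → b ^ k ≤ b * x →
              ∀ d .{{_ : NonZero d}} p → log[ b ] x ≤ p / d → d * k ≤ d + p
⌈log⌉-bound b 2≤b {x} {k} hi d p le = ^-cancelʳ-≤ b 2≤b (begin
  b ^ (d * k)     ≡⟨ cong (b ^_) (*-comm d k) ⟩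
  b ^ (k * d)     ≡⟨ ^-*-assoc b k d ⟨
  (b ^ k) ^ d     ≤⟨ ^-monoˡ-≤ d hi ⟩
  (b * x) ^ d     ≡⟨ *-^-distribʳ b x d ⟩
  b ^ d * x ^ d   ≤⟨ *-monoʳ-≤ (b ^ d) le ⟩
  b ^ d * b ^ p   ≡⟨ ^-distribˡ-+-* b d p ⟨
  b ^ (d + p)     ∎)
  where open ≤-Reasoning

constant-bound : ∀ {q C} n t m → q ≤ C → q ≤3log₃⟨ n ⟩+log[ t ]⟨ m ⟩+⟨ C ⟩
constant-bound n t m q≤C d p s _ _ = ≤-trans (*-monoʳ-≤ d q≤C) (m≤n+m _ (3 * p + s))

-- The constant `t + 4` pays `t` for naming the digits, 1 for rounding up `r`, and 3 for rounding up
-- `k`, which is counted three times.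
long-bound : ∀ t → 2 ≤ t → ∀ {k r n m C} → 3 ^ k ≤ 3 * n → t ^ r ≤ t * m → t + 4 ≤ C →
             (t + (r + 3 * k)) ≤3log₃⟨ n ⟩+log[ t ]⟨ m ⟩+⟨ C ⟩
long-bound t 2≤t {k} {r} {C = C} hk hr t+4≤C d p s hp hs = begin
  d * (t + (r + 3 * k))             ≡⟨ solve 4 (λ d t r k → d :* (t :+ (r :+ con 3 :* k))
                                         := d :* t :+ d :* r :+ con 3 :* (d :* k)) refl d t r k ⟩
  d * t + d * r + 3 * (d * k)       ≤⟨ +-mono-≤ (+-monoʳ-≤ (d * t) (⌈log⌉-bound t 2≤t hr d s hs))
                                         (*-monoʳ-≤ 3 (⌈log⌉-bound 3 (s≤s (s≤s z≤n)) hk d p hp)) ⟩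
  d * t + (d + s) + 3 * (d + p)     ≡⟨ solve 4 (λ d t s p → d :* t :+ (d :+ s) :+ con 3 :* (d :+ p)
                                         := con 3 :* p :+ s :+ d :* (t :+ con 4)) refl d t s p ⟩
  3 * p + s + d * (t + 4)           ≤⟨ +-monoʳ-≤ (3 * p + s) (*-monoʳ-≤ d t+4≤C) ⟩
  3 * p + s + d * C                 ∎
  where
  open ≤-Reasoning
  open +-*-Solver

mainTheorem17 : ∀ (t : ℕ) → 2 ≤ t →
    ∀ (f : ℕ → ℕ) → TendsToInfinity f →
    Σ[ C ∈ ℕ ]
    (∀ (n : ℕ) .{{_ : NonZero n}} (A : List (Vec Bool n)) →
    Unique A → length A ≡ f n →
    Σ[ φ ∈ Sentence ]
    (quantifiers φ ≤3log₃⟨ n ⟩+log[ t ]⟨ f n ⟩+⟨ C ⟩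
    × (∀ (w : Vec Bool n) → w ∈ A → 𝐁 w ⊨ φ)
    × (∀ (w : Vec Bool n) → w ∉ A → ¬ (𝐁 w ⊨ φ))))
mainTheorem17 t@(suc t′) 2≤t f _ = C , sentence
  where
  cost : ℕ → ℕ
  cost n = f n * n

  -- `t + 4` covers the long strings; the sum dominates the cost of each of the finitely many
  -- lengths up to `t`.
  C = t + 4 + sumUpTo cost t

  Separates : ∀ n .{{_ : NonZero n}} → List (Word n) → Set
  Separates n A = Σ[ φ ∈ Sentence ]
    (quantifiers φ ≤3log₃⟨ n ⟩+log[ t ]⟨ f n ⟩+⟨ C ⟩
    × (∀ w → w ∈ A → 𝐁 w ⊨ φ)
    × (∀ w → w ∉ A → ¬ (𝐁 w ⊨ φ)))

  short : ∀ n (A : List (Word (suc n))) → length A ≡ f (suc n) →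
          quantifiers (shortSentence A) ≤ C → Separates (suc n) A
  short n A len q≤C =
    shortSentence A , constant-bound (suc n) t (f (suc n)) q≤C , short-complete A , λ w w∉ → w∉ ∘ short-sound A w

  long : ∀ m (A : List (Word (3 + m))) → length A ≡ f (3 + m) → t ≤ 3 + m → Separates (3 + m) A
  -- Clipping indices needs a last member, so the empty set is treated separately, by the falsehood.
  long m []       len t≤n = short (2 + m) [] len z≤n
  long m (x ∷ xs) len t≤n =
    let k , n≤3ᵏ , 3ᵏ≤ = ⌈log⌉ 3 (s≤s (s≤s z≤n)) (2 + m)
        r , l≤tʳ , tʳ≤ = ⌈log⌉ t 2≤t (length xs)
    in longSentence t′ r k x xs ,
       subst₂ (λ q l → q ≤3log₃⟨ 3 + m ⟩+log[ t ]⟨ l ⟩+⟨ C ⟩) (sym (quantifiers-long t′ r k x xs)) len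
         (long-bound t 2≤t {k} {r} {3 + m} 3ᵏ≤ tʳ≤ (m≤m+n (t + 4) _)) ,
       long-complete t′ r k x xs n≤3ᵏ l≤tʳ t≤n ,
       λ w w∉ → w∉ ∘ long-sound t′ r k x xs n≤3ᵏ w

  sentence : ∀ n .{{_ : NonZero n}} (A : List (Word n)) → Unique A → length A ≡ f n → Separates n A
  sentence zero A _ len = contradiction (>-nonZero⁻¹ zero) λ ()
  sentence (suc n) A _ len with suc n ≤? t
  ... | yes n≤t = short n A len (≤-trans (≤-reflexive (quantifiers-short A))
          (≤-trans (*-mono-≤ (≤-reflexive len) (n≤1+n n)) (≤-trans (≤sumUpTo cost n≤t) (m≤n+m _ (t + 4)))))
  -- As 2 ≤ `t`, a length above `t` is at least 3, as the ternary description requires.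
  sentence (suc zero)          A _ len | no n≰t = contradiction (<⇒≤ 2≤t) n≰t
  sentence (suc (suc zero))    A _ len | no n≰t = contradiction 2≤t n≰t
  sentence (suc (suc (suc m))) A _ len | no n≰t = long m A len (<⇒≤ (≰⇒> n≰t))
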